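{- Let $R:\{0,1\}^n\times\{0,1\}^m\to[0,1]$ be a randomized $q$-query algorithm and consider its mean function $\mu_R(x):=\mathbb{E}_{r}[R(x,r)]$, where $r\sim\{0,1\}^m$ is uniform. There is a variable $i\in[n]$ such that $$\mathrm{Inf}_i(\mu_R):=\mathop{\mathbb{E}}_{x}\big[|\mu_R(x)-\mu_R(x^{\oplus i})|\big]\ \ge\ \frac{\mathrm{Var}(\mu_R)}{q},$$ where $x\sim\{0,1\}^n$ is uniform, $\mathrm{Var}(\mu_R)$ is the variance of $\mu_R(x)$, and $x^{\oplus i}$ denotes $x$ with its $i$-th coordinate flipped.
   Context: Query algorithms are represented as binary decision trees. An $n$-variable randomized decision tree is a binary tree with two types of internal nodes: decision nodes, which branch on the value of one of the boolean variables $x_1,\dots,x_n$, and stochastic nodes, which branch on the outcome of an independent $\mathrm{Bernoulli}(\frac12)$ random bit. Leaves are labelled by values in $[0,1]$. Its query complexity is the maximum number of decision nodes on any root-to-leaf path, and its randomness complexity is the maximum number $m$ of stochastic nodes on any root-to-leaf path. $R(x,r)$ is the label of the leaf reached on input $x$ when the stochastic nodes encountered branch according to the bits of $r\in\{0,1\}^m$. A randomized $q$-query algorithm is such a tree of query complexity at most $q$; here $n,q\ge1$. -}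

module Defs where

open import Level using (Level; suc; _⊔_)
open import Algebra.Bundles using (CommutativeRing)
open import Algebra.Core using (Op₁; Op₂)
import Algebra.Construct.NaturalChoice.Max as Max
import Algebra.Properties.Semiring.Mult as Mult
open import Data.Bool.Base using (Bool; true; false; not; if_then_else_)
open import Data.Fin.Base using (Fin)
open import Data.Nat.Base as ℕ using (ℕ)
import Data.Nat.Properties as ℕ
open import Data.Vec.Base using (Vec; []; _∷_; lookup; _[_]%=_)
open import Relation.Binary.Bundles using (TotalOrder)
open import Relation.Binary.Core using (Rel)
open import Relation.Binary.Structures using (IsTotalOrder)
open import Relation.Nullary.Negation.Core using (¬_)

-- The scalars are an arbitrary ordered field, of which the classical reals
-- are an instance.  The inverse is total; nothing is assumed about the value
-- of 0# ⁻¹.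
record OrderedField (c ℓ₁ ℓ₂ : Level) : Set (suc (c ⊔ ℓ₁ ⊔ ℓ₂)) where
  infix  4 _≤_
  infix  8 _⁻¹
  infixl 7 _/_
  field
    commutativeRing : CommutativeRing c ℓ₁

  open CommutativeRing commutativeRing public

  field
    _≤_          : Rel Carrier ℓ₂
    isTotalOrder : IsTotalOrder _≈_ _≤_
    +-monoˡ-≤    : ∀ z {x y} → x ≤ y → x + z ≤ y + z
    *-nonNeg     : ∀ {x y} → 0# ≤ x → 0# ≤ y → 0# ≤ x * y
    0≉1          : ¬ (0# ≈ 1#)
    _⁻¹          : Op₁ Carrier
    ⁻¹-cong      : ∀ {x y} → x ≈ y → x ⁻¹ ≈ y ⁻¹
    *-inverseʳ   : ∀ x → ¬ (x ≈ 0#) → x * x ⁻¹ ≈ 1#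

  totalOrder : TotalOrder c ℓ₁ ℓ₂
  totalOrder = record { isTotalOrder = isTotalOrder }

  open TotalOrder totalOrder public using (_≥_)

  open Mult semiring public using (_×_)

  _/_ : Op₂ Carrier
  x / y = x * y ⁻¹

  fromℕ : ℕ → Carrier
  fromℕ k = k × 1#

  ∣_∣ : Op₁ Carrier
  ∣ x ∣ = x max (- x)
    where open Max totalOrder renaming (_⊔_ to _max_)

module RandomizedQuery {c ℓ₁ ℓ₂ : Level} (F : OrderedField c ℓ₁ ℓ₂) where

  open OrderedField F

  ∑ : ∀ k → (Vec Bool k → Carrier) → Carrier
  ∑ ℕ.zero    f = f []
  ∑ (ℕ.suc k) f = ∑ k (λ x → f (false ∷ x)) + ∑ k (λ x → f (true ∷ x))

  𝔼 : ∀ k → (Vec Bool k → Carrier) → Carrier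
  𝔼 k f = ∑ k f / fromℕ (2 ℕ.^ k)

  Var : ∀ {n} → (Vec Bool n → Carrier) → Carrier
  Var {n} f = 𝔼 n (λ x → (f x - 𝔼 n f) * (f x - 𝔼 n f))

  flip : ∀ {n} → Fin n → Vec Bool n → Vec Bool n
  flip i x = x [ i ]%= not

  Inf : ∀ {n} → Fin n → (Vec Bool n → Carrier) → Carrier
  Inf {n} i f = 𝔼 n (λ x → ∣ f x - f (flip i x) ∣)

  -- At every internal node, the first subtree is taken on false and the
  -- second on true.
  data Tree (n : ℕ) : Set (c ⊔ ℓ₂) where
    leaf       : (v : Carrier) → 0# ≤ v → v ≤ 1# → Tree n
    decision   : Fin n → Tree n → Tree n → Tree n
    stochastic : Tree n → Tree n → Tree n

  queryComplexity : ∀ {n} → Tree n → ℕ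
  queryComplexity (leaf _ _ _)     = 0
  queryComplexity (decision _ s t) = ℕ.suc (queryComplexity s ℕ.⊔ queryComplexity t)
  queryComplexity (stochastic s t) = queryComplexity s ℕ.⊔ queryComplexity t

  randomness : ∀ {n} → Tree n → ℕ
  randomness (leaf _ _ _)     = 0
  randomness (decision _ s t) = randomness s ℕ.⊔ randomness t
  randomness (stochastic s t) = ℕ.suc (randomness s ℕ.⊔ randomness t)

  -- The k-th stochastic node met along the path consumes the k-th bit; bits
  -- left over at the leaf are ignored.  The bound on the number of bits is
  -- an inequality because a subtree may need fewer bits than remain.
  eval : ∀ {n m} (T : Tree n) → randomness T ℕ.≤ m →
         Vec Bool n → Vec Bool m → Carrier
  eval (leaf v _ _) _ x r = v
  eval (decision i s t) b x r =
    if lookup x i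
      then eval t (ℕ.m⊔n≤o⇒n≤o (randomness s) (randomness t) b) x r
      else eval s (ℕ.m⊔n≤o⇒m≤o (randomness s) (randomness t) b) x r
  eval (stochastic s t) (ℕ.s≤s b) x (ω ∷ r) =
    if ω
      then eval t (ℕ.m⊔n≤o⇒n≤o (randomness s) (randomness t) b) x r
      else eval s (ℕ.m⊔n≤o⇒m≤o (randomness s) (randomness t) b) x r

  run : ∀ {n} (R : Tree n) → Vec Bool n → Vec Bool (randomness R) → Carrier
  run R = eval R ℕ.≤-refl

  mean : ∀ {n} → Tree n → Vec Bool n → Carrier
  mean R x = 𝔼 (randomness R) (run R x)

-- Averaging over the random bits, it suffices to bound the covariance of a
-- decision tree f with a fixed function g by q · max Infᵢ g, and to take
-- g = μ.  If the root queries i, let s and t be the two subtrees with xᵢ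
-- fixed to false and to true.  Then s and t do not depend on xᵢ, and replacing
-- f by (s + t) / 2 changes 𝔼 (f g) by 𝔼 ((t - s) (g₁ - g₀)) / 4 ≤ Infᵢ g / 4,
-- where g₀ and g₁ are g with xᵢ set to false and to true.  Hence every level
-- of the tree costs at most one influence of g.  Since g is never restricted,
-- the same bound max Infᵢ g serves at all levels.

module Submission where

open import Defs
import Algebra.Construct.NaturalChoice.Max as Max
import Algebra.Properties.Ring as RingProperties
import Algebra.Properties.Semiring.Mult as Mult
import Algebra.Solver.Ring.NaturalCoefficients.Default as Solver
open import Data.Bool.Base using (Bool; true; false; not; if_then_else_)
open import Data.Empty using (⊥-elim)
open import Data.Fin.Base using (Fin; zero; suc)
open import Data.Fin.Properties using (_≟_)
open import Data.List.Base using (allFin)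
import Data.List.Extrema as Extrema
import Data.List.Relation.Unary.All as All
open import Data.List.Membership.Propositional.Properties using (∈-allFin)
open import Data.Nat.Base as ℕ using (ℕ)
import Data.Nat.Properties as ℕ
open import Data.Product.Base using (∃-syntax; _,_)
open import Data.Sum.Base using (_⊎_; inj₁; inj₂)
open import Data.Vec.Base using (Vec; []; _∷_; lookup; _[_]≔_)
open import Data.Vec.Properties
  using (lookup∘updateAt; lookup∘update′; lookup∘update; updateAt-updateAt; []≔-lookup)
open import Function.Base using (_∘_; id)
open import Relation.Binary.Bundles using (TotalOrder)
open import Relation.Binary.PropositionalEquality as ≡ using (_≡_)
import Relation.Binary.Reasoning.PartialOrder as PartialOrderReasoning
open import Relation.Binary.Structures using (IsTotalOrder)
open import Relation.Nullary.Decidable.Core using (yes; no)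
open import Relation.Nullary.Negation.Core using (¬_)

-- Arithmetic in an ordered field.

module OrderedFieldProperties {c ℓ₁ ℓ₂} (F : OrderedField c ℓ₁ ℓ₂) where

  open OrderedField F
  open IsTotalOrder isTotalOrder public
    using (total; antisym)
    renaming (refl to ≤-refl; trans to ≤-trans; reflexive to ≤-reflexive)
  open RingProperties ring public using (-‿involutive; -1*x≈-x; +-cancelʳ; ⁻¹-anti-homo-//)
  open Solver commutativeSemiring public
    using (solve; _:+_; _:*_; _:=_; con)
  open Mult semiring public using (×-homo-+)

  module ≤-Reasoning = PartialOrderReasoning (TotalOrder.poset totalOrder)
  open ≤-Reasoning

  +-monoʳ-≤ : ∀ z {x y} → x ≤ y → z + x ≤ z + y
  +-monoʳ-≤ z {x} {y} x≤y = begin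
    z + x ≈⟨ +-comm z x ⟩
    x + z ≤⟨ +-monoˡ-≤ z x≤y ⟩
    y + z ≈⟨ +-comm y z ⟩
    z + y ∎

  +-mono-≤ : ∀ {x y u v} → x ≤ y → u ≤ v → x + u ≤ y + v
  +-mono-≤ x≤y u≤v = ≤-trans (+-monoˡ-≤ _ x≤y) (+-monoʳ-≤ _ u≤v)

  x≈y+[x-y] : ∀ x y → x ≈ y + (x - y)
  x≈y+[x-y] x y = begin-equality
    x               ≈⟨ +-identityʳ x ⟨
    x + 0#          ≈⟨ +-congˡ (-‿inverseˡ y) ⟨
    x + (- y + y)   ≈⟨ +-assoc x (- y) y ⟨
    (x - y) + y     ≈⟨ +-comm (x - y) y ⟩
    y + (x - y)     ∎

  +-cancelˡ-≤ : ∀ z {x y} → z + x ≤ z + y → x ≤ y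
  +-cancelˡ-≤ z {x} {y} p = begin
    x               ≈⟨ lemma x ⟨
    - z + (z + x)   ≤⟨ +-monoʳ-≤ (- z) p ⟩
    - z + (z + y)   ≈⟨ lemma y ⟩
    y               ∎
    where
    lemma : ∀ w → - z + (z + w) ≈ w
    lemma w = begin-equality
      - z + (z + w) ≈⟨ +-assoc (- z) z w ⟨
      (- z + z) + w ≈⟨ +-congʳ (-‿inverseˡ z) ⟩
      0# + w        ≈⟨ +-identityˡ w ⟩
      w             ∎

  x≤y⇒0≤y-x : ∀ {x y} → x ≤ y → 0# ≤ y - x
  x≤y⇒0≤y-x {x} {y} x≤y = begin
    0#    ≈⟨ -‿inverseʳ x ⟨
    x - x ≤⟨ +-monoˡ-≤ (- x) x≤y ⟩
    y - x ∎

  x≤0⇒0≤-x : ∀ {x} → x ≤ 0# → 0# ≤ - x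
  x≤0⇒0≤-x {x} x≤0 = ≤-trans (x≤y⇒0≤y-x x≤0) (≤-reflexive (+-identityˡ (- x)))

  x≤x+y : ∀ x {y} → 0# ≤ y → x ≤ x + y
  x≤x+y x {y} 0≤y = ≤-trans (≤-reflexive (sym (+-identityʳ x))) (+-monoʳ-≤ x 0≤y)

  +-nonNeg : ∀ {x y} → 0# ≤ x → 0# ≤ y → 0# ≤ x + y
  +-nonNeg 0≤x 0≤y = ≤-trans 0≤x (x≤x+y _ 0≤y)

  *-monoˡ-≤ : ∀ {z} → 0# ≤ z → ∀ {x y} → x ≤ y → x * z ≤ y * z
  *-monoˡ-≤ {z} 0≤z {x} {y} x≤y = begin
    x * z               ≤⟨ x≤x+y (x * z) (*-nonNeg (x≤y⇒0≤y-x x≤y) 0≤z) ⟩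
    x * z + (y - x) * z ≈⟨ distribʳ z x (y - x) ⟨
    (x + (y - x)) * z   ≈⟨ *-congʳ (x≈y+[x-y] y x) ⟨
    y * z               ∎

  -- If y ≤ x, then x + x ≤ y + y ≤ x + y, and x cancels. Inequalities between averages are proved
  -- in doubled form and halved by this lemma, so no factor 1/2 ever appears.
  x+x≤y+y⇒x≤y : ∀ {x y} → x + x ≤ y + y → x ≤ y
  x+x≤y+y⇒x≤y {x} {y} p with total x y
  ... | inj₁ x≤y = x≤y
  ... | inj₂ y≤x = +-cancelˡ-≤ x (≤-trans p (+-monoˡ-≤ y y≤x))

  -- If 1 ≤ 0, then -1 is nonnegative, and so is its square, which is 1.
  0≤1 : 0# ≤ 1#
  0≤1 with total 0# 1#
  ... | inj₁ p = p
  ... | inj₂ p = begin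
    0#            ≤⟨ *-nonNeg (x≤0⇒0≤-x p) (x≤0⇒0≤-x p) ⟩
    - 1# * - 1#   ≈⟨ -1*x≈-x (- 1#) ⟩
    - - 1#        ≈⟨ -‿involutive 1# ⟩
    1#            ∎

  1≰0 : ¬ (1# ≤ 0#)
  1≰0 p = 0≉1 (antisym 0≤1 p)

  -- A nonpositive inverse multiplied by the nonnegative x would give 1 ≤ 0.
  ⁻¹-nonNeg : ∀ {x} → 0# ≤ x → ¬ (x ≈ 0#) → 0# ≤ x ⁻¹
  ⁻¹-nonNeg {x} 0≤x x≉0 with total 0# (x ⁻¹)
  ... | inj₁ p = p
  ... | inj₂ p = ⊥-elim (1≰0 (begin
    1#                  ≈⟨ *-inverseʳ x x≉0 ⟨
    x * x ⁻¹            ≈⟨ *-comm x (x ⁻¹) ⟩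
    x ⁻¹ * x            ≤⟨ *-monoˡ-≤ 0≤x p ⟩
    0# * x              ≈⟨ zeroˡ x ⟩
    0#                  ∎))

  fromℕ-mono : ∀ {j k} → j ℕ.≤ k → fromℕ j ≤ fromℕ k
  fromℕ-mono {k = ℕ.zero}  ℕ.z≤n = ≤-refl
  fromℕ-mono {k = ℕ.suc k} ℕ.z≤n = +-nonNeg 0≤1 (fromℕ-mono {k = k} ℕ.z≤n)
  fromℕ-mono (ℕ.s≤s j≤k) = +-monoʳ-≤ 1# (fromℕ-mono j≤k)

  fromℕ-nonNeg : ∀ k → 0# ≤ fromℕ k
  fromℕ-nonNeg k = fromℕ-mono {0} {k} ℕ.z≤n

  fromℕ≉0 : ∀ {k} → 1 ℕ.≤ k → ¬ (fromℕ k ≈ 0#)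
  fromℕ≉0 {k} 1≤k k≈0 = 1≰0 (begin
    1#       ≈⟨ +-identityʳ 1# ⟨
    fromℕ 1  ≤⟨ fromℕ-mono 1≤k ⟩
    fromℕ k  ≈⟨ k≈0 ⟩
    0#       ∎)

  /-≤ : ∀ {k x y} → 1 ℕ.≤ k → x ≤ fromℕ k * y → x / fromℕ k ≤ y
  /-≤ {k} {x} {y} 1≤k p = begin
    x * w               ≤⟨ *-monoˡ-≤ (⁻¹-nonNeg (fromℕ-nonNeg k) (fromℕ≉0 1≤k)) p ⟩
    fromℕ k * y * w     ≈⟨ solve 3 (λ a b d → a :* b :* d := b :* (a :* d)) refl (fromℕ k) y w ⟩
    y * (fromℕ k * w)   ≈⟨ *-congˡ (*-inverseʳ (fromℕ k) (fromℕ≉0 1≤k)) ⟩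
    y * 1#              ≈⟨ *-identityʳ y ⟩
    y                   ∎
    where w = fromℕ k ⁻¹

  x≤∣x∣ : ∀ x → x ≤ ∣ x ∣
  x≤∣x∣ x = Max.x≤x⊔y totalOrder x (- x)

  -x≤∣x∣ : ∀ x → - x ≤ ∣ x ∣
  -x≤∣x∣ x = Max.x≤y⊔x totalOrder x (- x)

  ∣x∣-nonNeg : ∀ x → 0# ≤ ∣ x ∣
  ∣x∣-nonNeg x with total 0# x
  ... | inj₁ 0≤x = ≤-trans 0≤x (x≤∣x∣ x)
  ... | inj₂ x≤0 = ≤-trans (x≤0⇒0≤-x x≤0) (-x≤∣x∣ x)

  private
    -- With u = v + d the two sides share all terms except s * d on the left and a + t * d on the
    -- right. Here s * d ≤ d ≤ a because s ≤ 1, and t * d is nonnegative.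
    exchange-ordered : ∀ {s t u v a} → s ≤ 1# → 0# ≤ t → v ≤ u → u - v ≤ a →
      (s * u + t * v) + (s * u + t * v) ≤ (s + t) * (u + v) + a
    exchange-ordered {s} {t} {u} {v} {a} s≤1 0≤t v≤u d≤a = begin
      (s * u + t * v) + (s * u + t * v)
        ≈⟨ +-cong (+-congʳ (*-congˡ u≈)) (+-congʳ (*-congˡ u≈)) ⟩
      (s * (v + d) + t * v) + (s * (v + d) + t * v)
        ≈⟨ solve 4 (λ s t v d → (s :* (v :+ d) :+ t :* v) :+ (s :* (v :+ d) :+ t :* v)
             := (s :* (v :+ v :+ d) :+ t :* (v :+ v)) :+ s :* d) refl s t v d ⟩
      (s * (v + v + d) + t * (v + v)) + s * d
        ≤⟨ +-monoʳ-≤ _ (≤-trans sd≤a (x≤x+y a (*-nonNeg 0≤t 0≤d))) ⟩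
      (s * (v + v + d) + t * (v + v)) + (a + t * d)
        ≈⟨ solve 5 (λ s t v d a → (s :* (v :+ v :+ d) :+ t :* (v :+ v)) :+ (a :+ t :* d)
             := (s :+ t) :* (v :+ d :+ v) :+ a) refl s t v d a ⟩
      (s + t) * (v + d + v) + a
        ≈⟨ +-congʳ (*-congˡ (+-congʳ u≈)) ⟨
      (s + t) * (u + v) + a ∎
      where
      d = u - v
      u≈ = x≈y+[x-y] u v
      0≤d = x≤y⇒0≤y-x v≤u
      sd≤a : s * d ≤ a
      sd≤a = begin
        s * d  ≤⟨ *-monoˡ-≤ 0≤d s≤1 ⟩
        1# * d ≈⟨ *-identityˡ d ⟩
        d      ≤⟨ d≤a ⟩
        a      ∎

  -- This is (s - t) * (u - v) ≤ ∣ u - v ∣ for s, t ∈ [0,1], written without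
  -- subtracting products.
  exchange : ∀ {s t} → 0# ≤ s → s ≤ 1# → 0# ≤ t → t ≤ 1# → ∀ u v →
    (s * u + t * v) + (s * u + t * v) ≤ (s + t) * (u + v) + ∣ u - v ∣
  exchange {s} {t} 0≤s s≤1 0≤t t≤1 u v with total v u
  ... | inj₁ v≤u = exchange-ordered s≤1 0≤t v≤u (x≤∣x∣ (u - v))
  ... | inj₂ u≤v = begin
    (s * u + t * v) + (s * u + t * v)   ≈⟨ +-cong (+-comm _ _) (+-comm _ _) ⟩
    (t * v + s * u) + (t * v + s * u)   ≤⟨ exchange-ordered t≤1 0≤s u≤v v-u≤ ⟩
    (t + s) * (v + u) + ∣ u - v ∣       ≈⟨ +-congʳ (*-cong (+-comm t s) (+-comm v u)) ⟩
    (s + t) * (u + v) + ∣ u - v ∣       ∎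
    where
    v-u≤ : v - u ≤ ∣ u - v ∣
    v-u≤ = begin
      v - u       ≈⟨ ⁻¹-anti-homo-// u v ⟨
      - (u - v)   ≤⟨ -x≤∣x∣ (u - v) ⟩
      ∣ u - v ∣   ∎

-- Sums, expectations and variance on the cube.

module ExpectationProperties {c ℓ₁ ℓ₂} (F : OrderedField c ℓ₁ ℓ₂) where

  open OrderedField F
  open RandomizedQuery F
  open OrderedFieldProperties F
  open ≤-Reasoning

  ∑-cong : ∀ k {f g} → (∀ x → f x ≈ g x) → ∑ k f ≈ ∑ k g
  ∑-cong ℕ.zero    f≈g = f≈g []
  ∑-cong (ℕ.suc k) f≈g = +-cong (∑-cong k (f≈g ∘ (false ∷_))) (∑-cong k (f≈g ∘ (true ∷_)))

  ∑-mono : ∀ k {f g} → (∀ x → f x ≤ g x) → ∑ k f ≤ ∑ k g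
  ∑-mono ℕ.zero    f≤g = f≤g []
  ∑-mono (ℕ.suc k) f≤g = +-mono-≤ (∑-mono k (f≤g ∘ (false ∷_))) (∑-mono k (f≤g ∘ (true ∷_)))

  ∑-+ : ∀ k f g → ∑ k (λ x → f x + g x) ≈ ∑ k f + ∑ k g
  ∑-+ ℕ.zero    f g = refl
  ∑-+ (ℕ.suc k) f g = trans (+-cong (∑-+ k _ _) (∑-+ k _ _))
    (solve 4 (λ a b d e → (a :+ b) :+ (d :+ e) := (a :+ d) :+ (b :+ e)) refl _ _ _ _)

  ∑-*ˡ : ∀ k a f → ∑ k (λ x → a * f x) ≈ a * ∑ k f
  ∑-*ˡ ℕ.zero    a f = refl
  ∑-*ˡ (ℕ.suc k) a f = trans (+-cong (∑-*ˡ k a _) (∑-*ˡ k a _)) (sym (distribˡ a _ _))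

  fromℕ-2^suc : ∀ k → fromℕ (2 ℕ.^ ℕ.suc k) ≈ fromℕ (2 ℕ.^ k) + fromℕ (2 ℕ.^ k)
  fromℕ-2^suc k = trans (×-homo-+ 1# (2 ℕ.^ k) _)
    (+-congˡ (trans (×-homo-+ 1# (2 ℕ.^ k) 0) (+-identityʳ _)))

  ∑-const : ∀ k a → ∑ k (λ _ → a) ≈ a * fromℕ (2 ℕ.^ k)
  ∑-const ℕ.zero    a = sym (trans (*-congˡ (+-identityʳ 1#)) (*-identityʳ a))
  ∑-const (ℕ.suc k) a = begin-equality
    ∑ k (λ _ → a) + ∑ k (λ _ → a)                     ≈⟨ +-cong (∑-const k a) (∑-const k a) ⟩
    a * fromℕ (2 ℕ.^ k) + a * fromℕ (2 ℕ.^ k)         ≈⟨ distribˡ a _ _ ⟨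
    a * (fromℕ (2 ℕ.^ k) + fromℕ (2 ℕ.^ k))           ≈⟨ *-congˡ (fromℕ-2^suc k) ⟨
    a * fromℕ (2 ℕ.^ ℕ.suc k)                         ∎

  -- Flipping the head coordinate exchanges the two halves of the sum; flipping a later one acts
  -- inside each half.
  ∑-flip : ∀ {k} i f → ∑ k (f ∘ flip i) ≈ ∑ k f
  ∑-flip zero    f = +-comm _ _
  ∑-flip (suc i) f = +-cong (∑-flip i (f ∘ (false ∷_))) (∑-flip i (f ∘ (true ∷_)))

  2^k≉0 : ∀ k → ¬ (fromℕ (2 ℕ.^ k) ≈ 0#)
  2^k≉0 k = fromℕ≉0 (ℕ.m^n>0 2 k)

  𝔼-cong : ∀ k {f g} → (∀ x → f x ≈ g x) → 𝔼 k f ≈ 𝔼 k g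
  𝔼-cong k f≈g = *-congʳ (∑-cong k f≈g)

  𝔼-mono : ∀ k {f g} → (∀ x → f x ≤ g x) → 𝔼 k f ≤ 𝔼 k g
  𝔼-mono k f≤g = *-monoˡ-≤ (⁻¹-nonNeg (fromℕ-nonNeg (2 ℕ.^ k)) (2^k≉0 k)) (∑-mono k f≤g)

  𝔼-+ : ∀ k f g → 𝔼 k (λ x → f x + g x) ≈ 𝔼 k f + 𝔼 k g
  𝔼-+ k f g = trans (*-congʳ (∑-+ k f g)) (distribʳ _ _ _)

  𝔼-*ˡ : ∀ k a f → 𝔼 k (λ x → a * f x) ≈ a * 𝔼 k f
  𝔼-*ˡ k a f = trans (*-congʳ (∑-*ˡ k a f)) (*-assoc _ _ _)

  𝔼-const : ∀ k a → 𝔼 k (λ _ → a) ≈ a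
  𝔼-const k a = begin-equality
    ∑ k (λ _ → a) / fromℕ (2 ℕ.^ k)                     ≈⟨ *-congʳ (∑-const k a) ⟩
    a * fromℕ (2 ℕ.^ k) * fromℕ (2 ℕ.^ k) ⁻¹            ≈⟨ *-assoc _ _ _ ⟩
    a * (fromℕ (2 ℕ.^ k) * fromℕ (2 ℕ.^ k) ⁻¹)          ≈⟨ *-congˡ (*-inverseʳ _ (2^k≉0 k)) ⟩
    a * 1#                                              ≈⟨ *-identityʳ a ⟩
    a                                                   ∎

  𝔼-flip : ∀ {k} i f → 𝔼 k (f ∘ flip i) ≈ 𝔼 k f
  𝔼-flip i f = *-congʳ (∑-flip i f)

  𝔼-symmetrize : ∀ {k} i f → 𝔼 k (λ x → f x + f (flip i x)) ≈ 𝔼 k f + 𝔼 k f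
  𝔼-symmetrize i f = trans (𝔼-+ _ f (f ∘ flip i)) (+-congˡ (𝔼-flip i f))

  -- Conditioning on the first bit, in doubled form. The normalisations are compared by inserting 1
  -- as `N * w` and cancelling `N + N`, which is the next power of two, against `w′`.
  𝔼-suc : ∀ k f → 𝔼 (ℕ.suc k) f + 𝔼 (ℕ.suc k) f ≈ 𝔼 k (f ∘ (false ∷_)) + 𝔼 k (f ∘ (true ∷_))
  𝔼-suc k f = begin-equality
    S * w′ + S * w′                 ≈⟨ *-identityʳ _ ⟨
    (S * w′ + S * w′) * 1#          ≈⟨ *-congˡ (*-inverseʳ N (2^k≉0 k)) ⟨
    (S * w′ + S * w′) * (N * w)     ≈⟨ solve 4 (λ s a n b → (s :* a :+ s :* a) :* (n :* b)
                                         := (s :* b) :* ((n :+ n) :* a)) refl S w′ N w ⟩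
    (S * w) * ((N + N) * w′)        ≈⟨ *-congˡ (*-congʳ (fromℕ-2^suc k)) ⟨
    (S * w) * (fromℕ (2 ℕ.^ ℕ.suc k) * w′)
                                    ≈⟨ *-congˡ (*-inverseʳ _ (2^k≉0 (ℕ.suc k))) ⟩
    (S * w) * 1#                    ≈⟨ *-identityʳ _ ⟩
    S * w                           ≈⟨ distribʳ w _ _ ⟩
    𝔼 k (f ∘ (false ∷_)) + 𝔼 k (f ∘ (true ∷_)) ∎
    where
    S = ∑ (ℕ.suc k) f
    N = fromℕ (2 ℕ.^ k)
    w = N ⁻¹
    w′ = fromℕ (2 ℕ.^ ℕ.suc k) ⁻¹

  Inf-nonNeg : ∀ {n} i (f : Vec Bool n → Carrier) → 0# ≤ Inf i f
  Inf-nonNeg {n} i f =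
    ≤-trans (≤-reflexive (sym (𝔼-const n 0#))) (𝔼-mono n (λ x → ∣x∣-nonNeg _))

  -- With m the mean, this averages the pointwise identity (f - m)² + 2mf = f² + m², which holds
  -- with f - m treated as an atom, so no negative factor is expanded. The extra m² added to both
  -- sides is what supplies the term 2mf.
  Var+[𝔼]² : ∀ {n} (f : Vec Bool n → Carrier) →
    Var f + 𝔼 n f * 𝔼 n f ≈ 𝔼 n (λ x → f x * f x)
  Var+[𝔼]² {n} f = +-cancelʳ (m * m) _ _ (begin-equality
    (Var f + m * m) + m * m
      ≈⟨ +-assoc _ _ _ ⟩
    Var f + (m * m + m * m)
      ≈⟨ +-congˡ (+-cong (𝔼-*ˡ n m f) (𝔼-*ˡ n m f)) ⟨
    Var f + (𝔼 n (λ x → m * f x) + 𝔼 n (λ x → m * f x))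
      ≈⟨ trans (𝔼-+ n _ _) (+-congˡ (𝔼-+ n _ _)) ⟨
    𝔼 n (λ x → (f x - m) * (f x - m) + (m * f x + m * f x))
      ≈⟨ 𝔼-cong n pointwise ⟩
    𝔼 n (λ x → f x * f x + m * m)
      ≈⟨ trans (𝔼-+ n _ _) (+-congˡ (𝔼-const n _)) ⟩
    𝔼 n (λ x → f x * f x) + m * m ∎)
    where
    m = 𝔼 n f
    pointwise : ∀ x → (f x - m) * (f x - m) + (m * f x + m * f x) ≈ f x * f x + m * m
    pointwise x = begin-equality
      d * d + (m * f x + m * f x)
        ≈⟨ +-congˡ (+-cong (*-congˡ f≈) (*-congˡ f≈)) ⟩
      d * d + (m * (m + d) + m * (m + d))
        ≈⟨ solve 2 (λ d m → d :* d :+ (m :* (m :+ d) :+ m :* (m :+ d))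
             := (m :+ d) :* (m :+ d) :+ m :* m) refl d m ⟩
      (m + d) * (m + d) + m * m
        ≈⟨ +-congʳ (*-cong f≈ f≈) ⟨
      f x * f x + m * m ∎
      where
      d = f x - m
      f≈ = x≈y+[x-y] (f x) m


-- Means of subtrees and partial assignments.

module CovarianceBound {c ℓ₁ ℓ₂} (F : OrderedField c ℓ₁ ℓ₂) where

  open OrderedField F
  open RandomizedQuery F
  open OrderedFieldProperties F
  open ExpectationProperties F
  open ≤-Reasoning

  eval-nonNeg : ∀ {n m} (T : Tree n) (b : randomness T ℕ.≤ m) x r → 0# ≤ eval T b x r
  eval-nonNeg (leaf v 0≤v v≤1) b x r = 0≤v
  eval-nonNeg (decision i s t) b x r with lookup x i
  ... | false = eval-nonNeg s _ x r
  ... | true  = eval-nonNeg t _ x r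
  eval-nonNeg (stochastic s t) (ℕ.s≤s b) x (false ∷ r) = eval-nonNeg s _ x r
  eval-nonNeg (stochastic s t) (ℕ.s≤s b) x (true ∷ r)  = eval-nonNeg t _ x r

  eval-≤1 : ∀ {n m} (T : Tree n) (b : randomness T ℕ.≤ m) x r → eval T b x r ≤ 1#
  eval-≤1 (leaf v 0≤v v≤1) b x r = v≤1
  eval-≤1 (decision i s t) b x r with lookup x i
  ... | false = eval-≤1 s _ x r
  ... | true  = eval-≤1 t _ x r
  eval-≤1 (stochastic s t) (ℕ.s≤s b) x (false ∷ r) = eval-≤1 s _ x r
  eval-≤1 (stochastic s t) (ℕ.s≤s b) x (true ∷ r)  = eval-≤1 t _ x r

  -- A subtree is averaged over all the bits that remain at its position, including those it never
  -- reads. Sibling subtrees are thus averaged over the same cube, and the effect of padding never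
  -- has to be analysed.
  paddedMean : ∀ {n m} (T : Tree n) → randomness T ℕ.≤ m → Vec Bool n → Carrier
  paddedMean {m = m} T b x = 𝔼 m (eval T b x)

  paddedMean-nonNeg : ∀ {n m} (T : Tree n) (b : randomness T ℕ.≤ m) x → 0# ≤ paddedMean T b x
  paddedMean-nonNeg {m = m} T b x =
    ≤-trans (≤-reflexive (sym (𝔼-const m 0#))) (𝔼-mono m (eval-nonNeg T b x))

  paddedMean-≤1 : ∀ {n m} (T : Tree n) (b : randomness T ℕ.≤ m) x → paddedMean T b x ≤ 1#
  paddedMean-≤1 {m = m} T b x =
    ≤-trans (𝔼-mono m (eval-≤1 T b x)) (≤-reflexive (𝔼-const m 1#))

  paddedMean-decision : ∀ {n m} i (s t : Tree n) (b : randomness (decision i s t) ℕ.≤ m) x →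
    paddedMean (decision i s t) b x ≈
      (if lookup x i then paddedMean t (ℕ.m⊔n≤o⇒n≤o (randomness s) (randomness t) b) x
                     else paddedMean s (ℕ.m⊔n≤o⇒m≤o (randomness s) (randomness t) b) x)
  paddedMean-decision i s t b x with lookup x i
  ... | false = refl
  ... | true  = refl

  -- A partial assignment, encoded as the map that overwrites the assigned coordinates. Restricted
  -- functions then still live on the whole cube, where they can be paired with the unrestricted
  -- `g`.
  Substitution : ∀ {n} → (Vec Bool n → Vec Bool n) → Set
  Substitution σ =
    ∀ i → (∃[ b ] ∀ x → lookup (σ x) i ≡ b) ⊎ (∀ x → lookup (σ x) i ≡ lookup x i)

  -- The new value is written before `σ` is applied, so an answer that `σ` already fixes takes
  -- precedence.
  Substitution-∘≔ : ∀ {n} (σ : Vec Bool n → Vec Bool n) → Substitution σ →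
    ∀ i b → Substitution (λ x → σ (x [ i ]≔ b))
  Substitution-∘≔ σ ρ i b j with ρ j
  ... | inj₁ (b′ , fixed) = inj₁ (b′ , λ x → fixed (x [ i ]≔ b))
  ... | inj₂ free with j ≟ i
  ...   | yes ≡.refl = inj₁ (b , λ x → ≡.trans (free _) (lookup∘update i x b))
  ...   | no j≢i = inj₂ λ x → ≡.trans (free _) (lookup∘update′ j≢i x b)

  -- Covariance with a fixed function of small influences.

  module _ {n} (g : Vec Bool n → Carrier)
           {I : Carrier} (0≤I : 0# ≤ I) (Inf≤I : ∀ i → Inf i g ≤ I) where

    -- This is Cov(f, g) ≤ k I, with the product of means moved to the right to avoid subtraction.
    record CovBound (k : ℕ) (f : Vec Bool n → Carrier) : Set ℓ₂ where
      constructor covBound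
      field
        bound : 𝔼 n (λ x → f x * g x) ≤ 𝔼 n f * 𝔼 n g + fromℕ k * I

    CovBound-cong : ∀ {k f f′} → (∀ x → f x ≈ f′ x) → CovBound k f′ → CovBound k f
    CovBound-cong {k} {f} {f′} f≈f′ (covBound p) = covBound (begin
      𝔼 n (λ x → f x * g x)             ≈⟨ 𝔼-cong n (λ x → *-congʳ (f≈f′ x)) ⟩
      𝔼 n (λ x → f′ x * g x)            ≤⟨ p ⟩
      𝔼 n f′ * 𝔼 n g + fromℕ k * I      ≈⟨ +-congʳ (*-congʳ (𝔼-cong n f≈f′)) ⟨
      𝔼 n f * 𝔼 n g + fromℕ k * I       ∎)

    CovBound-mono : ∀ {j k f} → j ℕ.≤ k → CovBound j f → CovBound k f
    CovBound-mono j≤k (covBound p) =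
      covBound (≤-trans p (+-monoʳ-≤ _ (*-monoˡ-≤ 0≤I (fromℕ-mono j≤k))))

    CovBound-const : ∀ a → CovBound 0 (λ _ → a)
    CovBound-const a = covBound (≤-reflexive (begin-equality
      𝔼 n (λ x → a * g x)               ≈⟨ 𝔼-*ˡ n a g ⟩
      a * 𝔼 n g                         ≈⟨ *-congʳ (𝔼-const n a) ⟨
      𝔼 n (λ _ → a) * 𝔼 n g             ≈⟨ +-identityʳ _ ⟨
      𝔼 n (λ _ → a) * 𝔼 n g + 0#        ≈⟨ +-congˡ (zeroˡ I) ⟨
      𝔼 n (λ _ → a) * 𝔼 n g + 0# * I    ∎))

    CovBound-sum : ∀ {k s t} → CovBound k s → CovBound k t →
      𝔼 n (λ x → (s x + t x) * g x) ≤ (𝔼 n s + 𝔼 n t) * 𝔼 n g + (fromℕ k * I + fromℕ k * I)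
    CovBound-sum {k} {s} {t} (covBound p) (covBound q) = begin
      𝔼 n (λ x → (s x + t x) * g x)
        ≈⟨ trans (𝔼-cong n (λ x → distribʳ (g x) (s x) (t x))) (𝔼-+ n _ _) ⟩
      𝔼 n (λ x → s x * g x) + 𝔼 n (λ x → t x * g x)
        ≤⟨ +-mono-≤ p q ⟩
      (𝔼 n s * 𝔼 n g + K) + (𝔼 n t * 𝔼 n g + K)
        ≈⟨ solve 4 (λ s t e k → (s :* e :+ k) :+ (t :* e :+ k) := (s :+ t) :* e :+ (k :+ k))
             refl _ _ _ _ ⟩
      (𝔼 n s + 𝔼 n t) * 𝔼 n g + (K + K) ∎
      where K = fromℕ k * I

    -- The case of a stochastic node: covariance with `g` is linear in f, so averaging two subtrees
    -- costs no influence.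
    CovBound-average : ∀ {k f s t} → (∀ x → f x + f x ≈ s x + t x) →
      CovBound k s → CovBound k t → CovBound k f
    CovBound-average {k} {f} {s} {t} f+f≈s+t p q = covBound (x+x≤y+y⇒x≤y (begin
      𝔼 n (λ x → f x * g x) + 𝔼 n (λ x → f x * g x)
        ≈⟨ 𝔼-+ n _ _ ⟨
      𝔼 n (λ x → f x * g x + f x * g x)
        ≈⟨ 𝔼-cong n (λ x → trans (sym (distribʳ (g x) (f x) (f x))) (*-congʳ (f+f≈s+t x))) ⟩
      𝔼 n (λ x → (s x + t x) * g x)
        ≤⟨ CovBound-sum p q ⟩
      (𝔼 n s + 𝔼 n t) * 𝔼 n g + (K + K)
        ≈⟨ +-congʳ (*-congʳ 𝔼s+𝔼t) ⟩
      (𝔼 n f + 𝔼 n f) * 𝔼 n g + (K + K)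
        ≈⟨ solve 3 (λ f e k → (f :+ f) :* e :+ (k :+ k) := (f :* e :+ k) :+ (f :* e :+ k))
             refl _ _ _ ⟩
      (𝔼 n f * 𝔼 n g + K) + (𝔼 n f * 𝔼 n g + K) ∎))
      where
      K = fromℕ k * I
      𝔼s+𝔼t : 𝔼 n s + 𝔼 n t ≈ 𝔼 n f + 𝔼 n f
      𝔼s+𝔼t = begin-equality
        𝔼 n s + 𝔼 n t            ≈⟨ 𝔼-+ n s t ⟨
        𝔼 n (λ x → s x + t x)    ≈⟨ 𝔼-cong n f+f≈s+t ⟨
        𝔼 n (λ x → f x + f x)    ≈⟨ 𝔼-+ n f f ⟩
        𝔼 n f + 𝔼 n f            ∎

    -- The case of a fresh query. On the pair x, `flip i x` the values of f are `s x` and `t x` in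
    -- some order; by `exchange`, replacing both by their average costs at most the change of `g`
    -- across the pair, and these changes average to `Inf i g`.
    CovBound-query : ∀ {k f s t} i →
      (∀ x → s (flip i x) ≈ s x) → (∀ x → t (flip i x) ≈ t x) →
      (∀ x → 0# ≤ s x) → (∀ x → s x ≤ 1#) → (∀ x → 0# ≤ t x) → (∀ x → t x ≤ 1#) →
      (∀ x → f x ≈ (if lookup x i then t x else s x)) →
      CovBound k s → CovBound k t → CovBound (ℕ.suc k) f
    CovBound-query {k} {f} {s} {t} i s-flip t-flip 0≤s s≤1 0≤t t≤1 f≈ p q =
      -- The inequality is proved at scale four: one doubling pairs each x with its flip, the other
      -- comes from `exchange`.
      covBound (x+x≤y+y⇒x≤y (x+x≤y+y⇒x≤y (begin
        (X + X) + (X + X)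
          ≈⟨ +-cong (𝔼-symmetrize i fg) (𝔼-symmetrize i fg) ⟨
        𝔼 n (λ x → fg x + fg (flip i x)) + 𝔼 n (λ x → fg x + fg (flip i x))
          ≈⟨ 𝔼-+ n _ _ ⟨
        𝔼 n (λ x → (fg x + fg (flip i x)) + (fg x + fg (flip i x)))
          ≤⟨ 𝔼-mono n pointwise ⟩
        𝔼 n (λ x → (u x + u (flip i x)) + ∣ g x - g (flip i x) ∣)
          ≈⟨ 𝔼-+ n _ _ ⟩
        𝔼 n (λ x → u x + u (flip i x)) + Inf i g
          ≈⟨ +-congʳ (𝔼-symmetrize i u) ⟩
        (𝔼 n u + 𝔼 n u) + Inf i g
          -- At scale four the new level may spend four copies of `I`. The query uses only one;
          -- three nonnegative copies pad it to the form required by `suc k`.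
          ≤⟨ +-mono-≤ (+-mono-≤ (CovBound-sum p q) (CovBound-sum p q))
                      (≤-trans (Inf≤I i) (x≤x+y I (+-nonNeg 0≤I (+-nonNeg 0≤I 0≤I)))) ⟩
        (((𝔼 n s + 𝔼 n t) * 𝔼 n g + (K + K)) + ((𝔼 n s + 𝔼 n t) * 𝔼 n g + (K + K)))
          + (I + (I + (I + I)))
          ≈⟨ +-congʳ (+-cong (+-congʳ (*-congʳ 𝔼s+𝔼t)) (+-congʳ (*-congʳ 𝔼s+𝔼t))) ⟩
        (((𝔼 n f + 𝔼 n f) * 𝔼 n g + (K + K)) + ((𝔼 n f + 𝔼 n f) * 𝔼 n g + (K + K)))
          + (I + (I + (I + I)))
          ≈⟨ solve 4 (λ f e k a →
               (((f :+ f) :* e :+ (k :* a :+ k :* a)) :+ ((f :+ f) :* e :+ (k :* a :+ k :* a)))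
                 :+ (a :+ (a :+ (a :+ a)))
               := ((f :* e :+ (con 1 :+ k) :* a) :+ (f :* e :+ (con 1 :+ k) :* a))
                 :+ ((f :* e :+ (con 1 :+ k) :* a) :+ (f :* e :+ (con 1 :+ k) :* a)))
               refl (𝔼 n f) (𝔼 n g) (fromℕ k) I ⟩
        (Y + Y) + (Y + Y) ∎)))
      where
      K = fromℕ k * I
      fg u : Vec Bool n → Carrier
      fg x = f x * g x
      u x = (s x + t x) * g x
      X = 𝔼 n fg
      Y = 𝔼 n f * 𝔼 n g + fromℕ (ℕ.suc k) * I

      f-false : ∀ x → lookup x i ≡ false → f x ≈ s x
      f-false x eq = trans (f≈ x) (reflexive (≡.cong (if_then t x else s x) eq))

      f-true : ∀ x → lookup x i ≡ true → f x ≈ t x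
      f-true x eq = trans (f≈ x) (reflexive (≡.cong (if_then t x else s x) eq))

      lookup-flip : ∀ x {b} → lookup x i ≡ b → lookup (flip i x) i ≡ not b
      lookup-flip x eq = ≡.trans (lookup∘updateAt i x) (≡.cong not eq)

      f+f : ∀ x → f x + f (flip i x) ≈ s x + t x
      f+f x with lookup x i in eq
      ... | false = +-cong (f-false x eq)
                           (trans (f-true (flip i x) (lookup-flip x eq)) (t-flip x))
      ... | true  = trans (+-comm _ _)
                      (+-cong (trans (f-false (flip i x) (lookup-flip x eq)) (s-flip x))
                              (f-true x eq))

      𝔼s+𝔼t : 𝔼 n s + 𝔼 n t ≈ 𝔼 n f + 𝔼 n f
      𝔼s+𝔼t = begin-equality
        𝔼 n s + 𝔼 n t                    ≈⟨ 𝔼-+ n s t ⟨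
        𝔼 n (λ x → s x + t x)            ≈⟨ 𝔼-cong n f+f ⟨
        𝔼 n (λ x → f x + f (flip i x))   ≈⟨ 𝔼-symmetrize i f ⟩
        𝔼 n f + 𝔼 n f                    ∎

      0≤f : ∀ x → 0# ≤ f x
      0≤f x with lookup x i in eq
      ... | false = ≤-trans (0≤s x) (≤-reflexive (sym (f-false x eq)))
      ... | true  = ≤-trans (0≤t x) (≤-reflexive (sym (f-true x eq)))

      f≤1 : ∀ x → f x ≤ 1#
      f≤1 x with lookup x i in eq
      ... | false = ≤-trans (≤-reflexive (f-false x eq)) (s≤1 x)
      ... | true  = ≤-trans (≤-reflexive (f-true x eq)) (t≤1 x)

      pointwise : ∀ x → (fg x + fg (flip i x)) + (fg x + fg (flip i x)) ≤
                        (u x + u (flip i x)) + ∣ g x - g (flip i x) ∣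
      pointwise x = begin
        (fg x + fg (flip i x)) + (fg x + fg (flip i x))
          ≤⟨ exchange (0≤f x) (f≤1 x) (0≤f (flip i x)) (f≤1 (flip i x)) (g x) (g (flip i x)) ⟩
        (f x + f (flip i x)) * (g x + g (flip i x)) + ∣ g x - g (flip i x) ∣
          ≈⟨ +-congʳ (trans (*-congʳ (f+f x)) (distribˡ _ _ _)) ⟩
        ((s x + t x) * g x + (s x + t x) * g (flip i x)) + ∣ g x - g (flip i x) ∣
          -- Since `s` and `t` ignore coordinate i, their sum in the second term may be read at
          -- `flip i x`.
          ≈⟨ +-congʳ (+-congˡ (*-congʳ (+-cong (s-flip x) (t-flip x)))) ⟨
        (u x + u (flip i x)) + ∣ g x - g (flip i x) ∣ ∎

    -- The substitution records the answers read so far, so that a variable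
    -- queried again further down the path is not charged twice and the two
    -- subtrees of a fresh query do not depend on the queried variable.
    covariance-bound : ∀ {m} (T : Tree n) (b : randomness T ℕ.≤ m) {σ} → Substitution σ →
                       CovBound (queryComplexity T) (paddedMean T b ∘ σ)
    covariance-bound {m} (leaf v _ _) b ρ = CovBound-cong (λ _ → 𝔼-const m v) (CovBound-const v)
    covariance-bound (stochastic s t) (ℕ.s≤s {n = m} b) {σ} ρ =
      -- The node consumes the first of the remaining bits, so `𝔼-suc` splits its mean into the two
      -- subtree means over the other m bits.
      CovBound-average (λ x → 𝔼-suc m (eval (stochastic s t) (ℕ.s≤s b) (σ x)))
        (CovBound-mono (ℕ.m≤m⊔n _ _) (covariance-bound s bₛ {σ} ρ))
        (CovBound-mono (ℕ.m≤n⊔m (queryComplexity s) _) (covariance-bound t bₜ {σ} ρ))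
      where
      bₛ = ℕ.m⊔n≤o⇒m≤o (randomness s) (randomness t) b
      bₜ = ℕ.m⊔n≤o⇒n≤o (randomness s) (randomness t) b
    covariance-bound (decision i s t) b {σ} ρ = by-cases (ρ i)
      where
      bₛ = ℕ.m⊔n≤o⇒m≤o (randomness s) (randomness t) b
      bₜ = ℕ.m⊔n≤o⇒n≤o (randomness s) (randomness t) b

      f₀ f₁ : Vec Bool n → Carrier
      f₀ = paddedMean s bₛ
      f₁ = paddedMean t bₜ

      branch : ∀ x {a} → lookup (σ x) i ≡ a →
               paddedMean (decision i s t) b (σ x) ≈ (if a then f₁ (σ x) else f₀ (σ x))
      branch x eq = trans (paddedMean-decision i s t b (σ x))
                          (reflexive (≡.cong (if_then f₁ (σ x) else f₀ (σ x)) eq))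

      -- Writing into coordinate i the value it already has changes nothing. The subtree mean at x
      -- therefore agrees with one that no longer depends on coordinate i, as `CovBound-query`
      -- requires.
      update-branch : ∀ x {a} → lookup x i ≡ a →
        (if a then f₁ (σ x) else f₀ (σ x)) ≡
        (if a then f₁ (σ (x [ i ]≔ true)) else f₀ (σ (x [ i ]≔ false)))
      update-branch x {false} eq =
        ≡.cong (f₀ ∘ σ) (≡.sym (≡.trans (≡.cong (x [ i ]≔_) (≡.sym eq)) ([]≔-lookup x i)))
      update-branch x {true} eq =
        ≡.cong (f₁ ∘ σ) (≡.sym (≡.trans (≡.cong (x [ i ]≔_) (≡.sym eq)) ([]≔-lookup x i)))

      by-cases : (∃[ a ] ∀ x → lookup (σ x) i ≡ a) ⊎ (∀ x → lookup (σ x) i ≡ lookup x i) →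
                 CovBound (queryComplexity (decision i s t)) (paddedMean (decision i s t) b ∘ σ)
      -- The answer is already determined, so the node acts as one of its subtrees and the unit for
      -- this level stays unspent.
      by-cases (inj₁ (false , fixed)) = CovBound-cong (λ x → branch x (fixed x))
        (CovBound-mono (ℕ.m≤n⇒m≤1+n (ℕ.m≤m⊔n _ _)) (covariance-bound s bₛ {σ} ρ))
      by-cases (inj₁ (true , fixed)) = CovBound-cong (λ x → branch x (fixed x))
        (CovBound-mono (ℕ.m≤n⇒m≤1+n (ℕ.m≤n⊔m (queryComplexity s) _)) (covariance-bound t bₜ {σ} ρ))
      by-cases (inj₂ free) = CovBound-query i
        -- Overwriting coordinate i erases a preceding flip of it.
        (λ x → reflexive (≡.cong (f₀ ∘ σ) (updateAt-updateAt i x)))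
        (λ x → reflexive (≡.cong (f₁ ∘ σ) (updateAt-updateAt i x)))
        (λ x → paddedMean-nonNeg s bₛ _) (λ x → paddedMean-≤1 s bₛ _)
        (λ x → paddedMean-nonNeg t bₜ _) (λ x → paddedMean-≤1 t bₜ _)
        (λ x → trans (branch x (free x)) (reflexive (update-branch x ≡.refl)))
        (CovBound-mono (ℕ.m≤m⊔n _ _)
          (covariance-bound s bₛ {λ x → σ (x [ i ]≔ false)} (Substitution-∘≔ σ ρ i false)))
        (CovBound-mono (ℕ.m≤n⊔m (queryComplexity s) _)
          (covariance-bound t bₜ {λ x → σ (x [ i ]≔ true)} (Substitution-∘≔ σ ρ i true)))

  -- The covariance of the mean with itself is its variance, so f and `g` are both taken to be
  -- `mean R`. At the root nothing has been read and no bit is padded, hence the identity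
  -- substitution and `ℕ.≤-refl`.
  Var-mean-≤ : ∀ {n} (R : Tree n) {I} → 0# ≤ I → (∀ i → Inf i (mean R) ≤ I) →
    Var (mean R) ≤ fromℕ (queryComplexity R) * I
  Var-mean-≤ {n} R {I} 0≤I Inf≤I = +-cancelˡ-≤ (𝔼 n μ * 𝔼 n μ) (begin
    𝔼 n μ * 𝔼 n μ + Var μ       ≈⟨ trans (+-comm _ _) (Var+[𝔼]² μ) ⟩
    𝔼 n (λ x → μ x * μ x)       ≤⟨ CovBound.bound (covariance-bound μ 0≤I Inf≤I R ℕ.≤-refl {id}
                                     (λ _ → inj₂ λ _ → ≡.refl)) ⟩
    𝔼 n μ * 𝔼 n μ + fromℕ (queryComplexity R) * I ∎)
    where μ = mean R

-- Choice of the most influential variable.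

lemma2p1 : ∀ {c ℓ₁ ℓ₂} (F : OrderedField c ℓ₁ ℓ₂) →
    let open OrderedField F
        open RandomizedQuery F in
    ∀ (n q : ℕ) → 1 ℕ.≤ n → 1 ℕ.≤ q →
    ∀ (R : Tree n) → queryComplexity R ℕ.≤ q →
    ∃[ i ] Inf i (mean R) ≥ Var (mean R) / fromℕ q
lemma2p1 F (ℕ.suc n) q _ 1≤q R qc≤q = i , /-≤ 1≤q (begin
    Var (mean R)                              ≤⟨ Var-mean-≤ R 0≤Infᵢ Inf≤Infᵢ ⟩
    fromℕ (queryComplexity R) * Inf i (mean R) ≤⟨ *-monoˡ-≤ 0≤Infᵢ (fromℕ-mono qc≤q) ⟩
    fromℕ q * Inf i (mean R)                  ∎)
  where
  open OrderedField F hiding (zero)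
  open RandomizedQuery F
  open OrderedFieldProperties F
  open ExpectationProperties F
  open CovarianceBound F
  open ≤-Reasoning
  open Extrema totalOrder using (argmax; f[xs]≤f[argmax])

  influence : Fin (ℕ.suc n) → Carrier
  influence j = Inf j (mean R)

  i : Fin (ℕ.suc n)
  -- The default `zero` exists because there is at least one variable; it is itself one of the
  -- candidates.
  i = argmax influence zero (allFin (ℕ.suc n))

  0≤Infᵢ : 0# ≤ Inf i (mean R)
  0≤Infᵢ = Inf-nonNeg i (mean R)

  Inf≤Infᵢ : ∀ j → Inf j (mean R) ≤ Inf i (mean R)
  Inf≤Infᵢ j = All.lookup (f[xs]≤f[argmax] {f = influence} zero (allFin (ℕ.suc n))) (∈-allFin j)
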